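{- For every Boolean function $f:2^V\to\{0,1\}$ we have $f^{ii}=f^\circ$, where $f^{ii}=(f^i)^i$.
   Context: $V$ is a finite set of Boolean variables. A Boolean function on $V$ is a map $f:2^V\to\{0,1\}$; its true sets are the sets $Z\subseteq V$ with $f(Z)=1$, and $\mathcal{T}(f)$ is the family of true sets. Write $f\le g$ if $f(X)\le g(X)$ for all $X\subseteq V$. For $B\subsetneq V$ and $v\in V\setminus B$, the definite Horn clause $B\to v$ is the Boolean function whose true sets are the sets $T$ with $B\not\subseteq T$ or $B\cup\{v\}\subseteq T$. It is an implicate of $f$ if $f\le (B\to v)$. For a hypergraph $\mathcal{H}\subseteq 2^V$ let $\Phi_{\mathcal{H}}=\bigwedge_{H\in\mathcal{H}}\bigwedge_{v\in H}((H\setminus\{v\})\to v)$ (the empty conjunction is the constant $1$). A Boolean function is hypergraph Horn if it equals $\Phi_{\mathcal{H}}$ for some hypergraph $\mathcal{H}\subseteq 2^V$. A set $I\subseteq V$ is an implicate set of $f$ if $(I\setminus\{v\})\to v$ is an implicate of $f$ for all $v\in I$; $\mathcal{I}(f)$ is the family of implicate sets. $f^\circ=\Phi_{\mathcal{I}(f)}$ is the unique minimal hypergraph Horn majorant of $f$. The implicate-dual $f^i$ of a Boolean function $f$ is the Boolean function defined by $\mathcal{T}(f^i)=\{V\setminus I\mid I\in\mathcal{I}(f)\}$. -}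

module Defs where

open import Data.Bool.Base using (Bool; true) renaming (_≤_ to _≤ᵇ_)
open import Data.Bool.Properties using () renaming (_≟_ to _≟ᵇ_; _≤?_ to _≤ᵇ?_)
open import Data.Fin.Base using (Fin)
open import Data.Fin.Properties using (all?)
open import Data.Fin.Subset using (Subset; _∈_; _⊆_; _⊈_; _∪_; _-_; ∁; ⁅_⁆)
open import Data.Fin.Subset.Properties using (_∈?_; _⊆?_; anySubset?)
open import Data.Nat.Base using (ℕ)
open import Data.Product.Base using (∃; _×_; _,_)
open import Data.Sum.Base using (_⊎_)
open import Data.Vec.Properties using (≡-dec)
open import Level using (0ℓ)
open import Relation.Binary.PropositionalEquality using (_≡_)
open import Relation.Nullary.Decidable
  using (Dec; does; map′; ¬?; _×-dec_; _⊎-dec_; _→-dec_; decidable-stable)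
open import Relation.Unary using (Pred; Decidable)

allSubset? : {n : ℕ} {P : Pred (Subset n) 0ℓ} → Decidable P → Dec (∀ X → P X)
allSubset? P? = map′
  (λ ¬∃¬P X → decidable-stable (P? X) (λ ¬PX → ¬∃¬P (X , ¬PX)))
  (λ ∀P (X , ¬PX) → ¬PX (∀P X))
  (¬? (anySubset? (λ X → ¬? (P? X))))

-- The set V of variables is Fin n.
BoolFun : ℕ → Set
BoolFun n = Subset n → Bool

𝒯 : {n : ℕ} → BoolFun n → Pred (Subset n) 0ℓ
𝒯 f Z = f Z ≡ true

𝒯? : {n : ℕ} (f : BoolFun n) → Decidable (𝒯 f)
𝒯? f Z = f Z ≟ᵇ true

infix 4 _≤_ _≤?_
infix 4 _⟶_

_≤_ : {n : ℕ} → BoolFun n → BoolFun n → Set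
f ≤ g = ∀ X → f X ≤ᵇ g X

_≤?_ : {n : ℕ} (f g : BoolFun n) → Dec (f ≤ g)
f ≤? g = allSubset? (λ X → f X ≤ᵇ? g X)

-- A definite Horn clause when v ∉ B, which holds in every use below, since B is
-- there of the form H - v.
_⟶_ : {n : ℕ} → Subset n → Fin n → BoolFun n
(B ⟶ v) T = does true?
  where
  true? : Dec (B ⊈ T ⊎ B ∪ ⁅ v ⁆ ⊆ T)
  true? = ¬? (B ⊆? T) ⊎-dec (B ∪ ⁅ v ⁆ ⊆? T)

-- A hypergraph is a decidable family of subsets; Φ is the conjunction, over H in
-- the family and v ∈ H, of the clauses H - v ⟶ v.
Models : {n : ℕ} → Pred (Subset n) 0ℓ → Pred (Subset n) 0ℓ
Models ℋ T = ∀ H → ℋ H → ∀ v → v ∈ H → 𝒯 (H - v ⟶ v) T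

models? : {n : ℕ} {ℋ : Pred (Subset n) 0ℓ} → Decidable ℋ → Decidable (Models ℋ)
models? ℋ? T = allSubset? λ H → ℋ? H →-dec all? λ v →
  (v ∈? H) →-dec 𝒯? (H - v ⟶ v) T

Φ : {n : ℕ} {ℋ : Pred (Subset n) 0ℓ} → Decidable ℋ → BoolFun n
Φ ℋ? T = does (models? ℋ? T)

Implicate : {n : ℕ} → BoolFun n → Subset n → Fin n → Set
Implicate f B v = f ≤ (B ⟶ v)

ImplicateSet : {n : ℕ} → BoolFun n → Pred (Subset n) 0ℓ
ImplicateSet f I = ∀ v → v ∈ I → Implicate f (I - v) v

implicateSet? : {n : ℕ} (f : BoolFun n) → Decidable (ImplicateSet f)
implicateSet? f I = all? λ v → (v ∈? I) →-dec (f ≤? (I - v ⟶ v))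

infix 8 _° _ⁱ

_° : {n : ℕ} → BoolFun n → BoolFun n
f ° = Φ (implicateSet? f)

ImplicateSetComplement : {n : ℕ} → BoolFun n → Pred (Subset n) 0ℓ
ImplicateSetComplement f Z = ∃ λ I → ImplicateSet f I × Z ≡ ∁ I

implicateSetComplement? : {n : ℕ} (f : BoolFun n) → Decidable (ImplicateSetComplement f)
implicateSetComplement? f Z =
  anySubset? λ I → implicateSet? f I ×-dec ≡-dec _≟ᵇ_ Z (∁ I)

_ⁱ : {n : ℕ} → BoolFun n → BoolFun n
(f ⁱ) Z = does (implicateSetComplement? f Z)

{-# OPTIONS --safe #-}
-- A clause H - v ⟶ v with v ∈ H fails at T exactly when v is the only element of
-- H outside T. So T satisfies all the clauses of H iff H and ∁ T do not meet in a
-- single element, a condition symmetric in H and ∁ T. The true sets of f ⁱ are the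
-- complements of the implicate sets of f, so both sides of the theorem are true at Z
-- iff no implicate set of f meets ∁ Z in a single element.
module Submission where

open import Defs
open import Algebra.Lattice.Properties.BooleanAlgebra using (¬-involutive)
open import Data.Bool.Base using (Bool; true; false; f≤t; b≤b) renaming (_≤_ to _≤ᵇ_)
open import Data.Fin.Base using (Fin)
open import Data.Fin.Subset using (Subset; _∈_; _∉_; _⊆_; _⊈_; _∩_; _∪_; _-_; ∁; ⁅_⁆)
open import Data.Fin.Subset.Properties
open import Data.Nat.Base using (ℕ)
open import Data.Product.Base using (_,_; proj₁; proj₂)
open import Data.Sum.Base using (_⊎_; inj₁; inj₂; [_,_]′)
open import Function.Bundles using (_⇔_; mk⇔; module Equivalence)
open import Function.Construct.Composition using (_⇔-∘_)
open import Relation.Binary.PropositionalEquality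
  using (_≡_; _≢_; _≗_; refl; sym; trans; subst)
open import Relation.Nullary.Decidable
  using (Dec; yes; no; does; ¬?; _⊎-dec_; dec-true; does-⇔)
open import Relation.Nullary.Negation using (contradiction)

open Equivalence using (to; from)

private
  variable
    n : ℕ
    A B T Z : Subset n
    v : Fin n

∁-involutive : (A : Subset n) → ∁ (∁ A) ≡ A
∁-involutive = ¬-involutive (∪-∩-booleanAlgebra _)

-- Removing a member of `A - v` shrinks it strictly, yet removing `v` a second time changes nothing.
x∉p-x : (A : Subset n) (v : Fin n) → v ∉ A - v
x∉p-x A v v∈A-v = ⊂-irref (p─q─q≡p─q A ⁅ v ⁆) (x∈p⇒p-x⊂p v∈A-v)

does≡true⇔ : {P : Set} (P? : Dec P) → does P? ≡ true ⇔ P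
does≡true⇔ P? = mk⇔ (witness P?) (dec-true P?)
  where
  witness : {P : Set} (P? : Dec P) → does P? ≡ true → P
  witness (yes p) _ = p

≤ᵇ⇔ : {x y : Bool} → (x ≤ᵇ y) ⇔ (x ≡ true → y ≡ true)
≤ᵇ⇔ = mk⇔ (λ { f≤t _ → refl ; b≤b p → p }) intro
  where
  intro : {x y : Bool} → (x ≡ true → y ≡ true) → x ≤ᵇ y
  intro {false} {false} _ = b≤b
  intro {false} {true}       _ = f≤t
  intro {true}                    h rewrite h refl = b≤b

infix 4 _⊥₁_

-- The orthogonality of circuits and cocircuits in matroid theory. Naming the common element,
-- instead of counting, matches the index `v` of a clause.
_⊥₁_ : Subset n → Subset n → Set
A ⊥₁ B = ∀ v → A ∩ B ≢ ⁅ v ⁆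

⊥₁-sym : A ⊥₁ B → B ⊥₁ A
⊥₁-sym {A = A} {B} A⊥B v eq = A⊥B v (trans (∩-comm A B) eq)

A∩B≡⁅v⁆⇒v∈A : A ∩ B ≡ ⁅ v ⁆ → v ∈ A
A∩B≡⁅v⁆⇒v∈A {A = A} {B} {v} eq =
  proj₁ (x∈p∩q⁻ A B (subst (v ∈_) (sym eq) (x∈⁅x⁆ v)))

clause-true⇔ : v ∈ A → 𝒯 (A - v ⟶ v) T ⇔ (A ∩ ∁ T ≢ ⁅ v ⁆)
clause-true⇔ {v = v} {A} {T} v∈A = mk⇔ sound (complete (A - v ⊆? T) (v ∈? T))
                               ⇔-∘ does≡true⇔ true?
  where
  Satisfied = A - v ⊈ T ⊎ (A - v) ∪ ⁅ v ⁆ ⊆ T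

  -- Repeats the decision inside `_⟶_`, so that `does true?` unfolds to the value of the clause at
  -- `T`.
  true? : Dec Satisfied
  true? = ¬? (A - v ⊆? T) ⊎-dec ((A - v) ∪ ⁅ v ⁆ ⊆? T)

  sound : Satisfied → A ∩ ∁ T ≢ ⁅ v ⁆
  sound (inj₁ A-v⊈T) eq = A-v⊈T λ {u} u∈A-v → x∉∁p⇒x∈p λ u∈∁T →
    x∉p-x A v (subst (_∈ A - v)
      (x∈⁅y⁆⇒x≡y v (subst (u ∈_) eq (x∈p∩q⁺ (p─q⊆p A ⁅ v ⁆ u∈A-v , u∈∁T)))) u∈A-v)
  sound (inj₂ A-v∪v⊆T) eq =
    x∈p⇒x∉∁p (A-v∪v⊆T (x∈p∪q⁺ (inj₂ (x∈⁅x⁆ v))))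
      (A∩B≡⁅v⁆⇒v∈A (trans (∩-comm (∁ T) A) eq))

  complete : Dec (A - v ⊆ T) → Dec (v ∈ T) → A ∩ ∁ T ≢ ⁅ v ⁆ → Satisfied
  complete (no A-v⊈T)  _         _   = inj₁ A-v⊈T
  complete (yes A-v⊆T) (yes v∈T) _   = inj₂ λ {u} u∈ →
    [ A-v⊆T , (λ u∈v → subst (_∈ T) (sym (x∈⁅y⁆⇒x≡y v u∈v)) v∈T) ]′
      (x∈p∪q⁻ (A - v) ⁅ v ⁆ u∈)
  -- Here `v` is the only element of `A` outside `T`, which `neq` excludes.
  complete (yes A-v⊆T) (no v∉T)  neq = contradiction (⊆-antisym only-v v-in) neq
    where
    only-v : A ∩ ∁ T ⊆ ⁅ v ⁆
    only-v {u} u∈ with u ∈? ⁅ v ⁆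
    ... | yes u∈v = u∈v
    ... | no  u∉v = contradiction
      (A-v⊆T (x∈p∧x∉q⇒x∈p─q (proj₁ (x∈p∩q⁻ A (∁ T) u∈)) u∉v))
      (x∈∁p⇒x∉p (proj₂ (x∈p∩q⁻ A (∁ T) u∈)))

    v-in : ⁅ v ⁆ ⊆ A ∩ ∁ T
    v-in u∈v rewrite x∈⁅y⁆⇒x≡y v u∈v = x∈p∩q⁺ (v∈A , x∉p⇒x∈∁p v∉T)

-- Orthogonality ranges over all `v`, but a `v` with `A ∩ ∁ T ≡ ⁅ v ⁆` lies in `A` and so has a
-- clause.
clauses-true⇔⊥₁ : (∀ v → v ∈ A → 𝒯 (A - v ⟶ v) T) ⇔ A ⊥₁ ∁ T
clauses-true⇔⊥₁ = mk⇔
  (λ clauses v eq → let v∈A = A∩B≡⁅v⁆⇒v∈A eq in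
    to (clause-true⇔ v∈A) (clauses v v∈A) eq)
  (λ A⊥∁T v v∈A → from (clause-true⇔ v∈A) (A⊥∁T v))

-- Exchanging the quantifiers over `v` and `T` gathers all clauses of `A` at one true set `T`.
implicateSet⇔⊥₁ : (f : BoolFun n) → ImplicateSet f A ⇔ (∀ T → 𝒯 f T → A ⊥₁ ∁ T)
implicateSet⇔⊥₁ f = mk⇔
  (λ implicate T fT → to clauses-true⇔⊥₁ λ v v∈A → to ≤ᵇ⇔ (implicate v v∈A T) fT)
  (λ A⊥ v v∈A T → from ≤ᵇ⇔ λ fT → from clauses-true⇔⊥₁ (A⊥ T fT) v v∈A)

complement⇔ : (f : BoolFun n) → ImplicateSetComplement f Z ⇔ ImplicateSet f (∁ Z)
complement⇔ {Z = Z} f = mk⇔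
  (λ { (I , implicate , refl) → subst (ImplicateSet f) (sym (∁-involutive I)) implicate })
  (λ implicate → ∁ Z , implicate , sym (∁-involutive Z))

ⁱ-true⇔ : (f : BoolFun n) → 𝒯 (f ⁱ) T ⇔ ImplicateSet f (∁ T)
ⁱ-true⇔ f = complement⇔ f ⇔-∘ does≡true⇔ (implicateSetComplement? f _)

-- Both sides say that `∁ Z` is orthogonal to every implicate set `H` of `f`: on the left `H`
-- appears as `∁ T` for a true set `T` of `f ⁱ`, and symmetry swaps the roles of `H` and `∁ Z`.
implicateSet-ⁱ⇔models : (f : BoolFun n) →
  ImplicateSet (f ⁱ) (∁ Z) ⇔ Models (ImplicateSet f) Z
implicateSet-ⁱ⇔models {Z = Z} f = mk⇔
  (λ implicate H H∈ℐ → from clauses-true⇔⊥₁ (⊥₁-sym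
    (subst (∁ Z ⊥₁_) (∁-involutive H)
      (to (implicateSet⇔⊥₁ (f ⁱ)) implicate (∁ H)
        (from (ⁱ-true⇔ f) (subst (ImplicateSet f) (sym (∁-involutive H)) H∈ℐ))))))
  (λ models → from (implicateSet⇔⊥₁ (f ⁱ)) λ T fⁱT →
    ⊥₁-sym (to clauses-true⇔⊥₁ (models (∁ T) (to (ⁱ-true⇔ f) fⁱT))))

lemma17 : (n : ℕ) (f : BoolFun n) → (f ⁱ) ⁱ ≗ f °
lemma17 n f Z = does-⇔ (implicateSet-ⁱ⇔models f ⇔-∘ complement⇔ (f ⁱ))
  (implicateSetComplement? (f ⁱ) Z) (models? (implicateSet? f) Z)
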